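{- Let $r\geq 1$ and $d>r$ be integers and let $A_1,\dots,A_r$ be fixed positive integers. For each $i$ let $H^{(i)}$ be any one of the sequences (indexed by positive integers $n$) $A_i^{n}n!$, $A_i^{n}n!!$, $A_i^{n}[1,\dots,n]$, $A_i^{n}\,n\#$, or $A_i^{p_n}\,p_n\#$ (the choice may depend on $i$). Then the equation $$x^d=\prod_{i=1}^r H^{(i)}_{n_i}$$ has only finitely many solutions $(x,n_1,\dots,n_r)$ with $x\in\mathbb{Z}$ and $n_1,\dots,n_r$ positive integers.
   Context: $[1,\dots,n]$ is the least common multiple of $1,\dots,n$; $n!!$ is the double factorial; $n\#$ is the product of all primes $\leq n$; $p_n$ is the $n$-th prime and $p_n\#$ is the product of the first $n$ primes. -}

module Defs where

open import Data.Fin.Base using (Fin)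
open import Data.List.Base using (List; []; _∷_; map; foldr; filter; upTo; tabulate)
open import Data.List.Membership.Propositional using (_∈_)
open import Data.List.Relation.Unary.All using (All; []; _∷_)
open import Data.Nat.Base using (ℕ; zero; suc; _+_; _*_; _∸_; _^_; _!; _≤_; _<_)
open import Data.Nat.Divisibility using (_∣_; divides; ∣m+n∣m⇒∣n; ∣1⇒≡1; m≤n⇒m!∣n!; m∣m*n; ∣-trans)
open import Data.Nat.LCM using (lcm)
open import Data.Nat.ListAction using (product)
open import Data.Nat.Primality using (Prime; prime?; ¬prime[0]; ¬prime[1])
open import Data.Nat.Primality.Factorisation using (PrimeFactorisation; factorise)
open import Data.Nat.Properties using (+-identityʳ; +-suc; *-comm; +-monoˡ-≤; 1≤n!; <⇒≢; ≰⇒>; n<1+n; m<n⇒m<1+n; m+[n∸m]≡n; ≤∧≢⇒<)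
open import Data.Product.Base using (∃-syntax; _×_; _,_)
open import Data.Vec.Base using (Vec; lookup)
open import Function.Bundles using (_⇔_)
open import Level using (Level; _⊔_)
open import Relation.Binary.PropositionalEquality using (_≡_; refl; sym; trans; subst)
open import Relation.Nullary.Decidable.Core using (yes; no)
open import Relation.Nullary.Negation.Core using (contradiction)
open import Relation.Unary using (Pred)

private
  variable
    a ℓ : Level

Finite : {A : Set a} → Pred A ℓ → Set (a ⊔ ℓ)
Finite P = ∃[ xs ] (∀ x → P x ⇔ x ∈ xs)

-- [ 1 , 2 , … , n ]
oneTo : ℕ → List ℕ
oneTo n = map suc (upTo n)

infix 8 _!! _#

_!! : ℕ → ℕ
0 !!             = 1
1 !!             = 1
(suc (suc n)) !! = suc (suc n) * n !!

lcmUpTo : ℕ → ℕ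
lcmUpTo n = foldr lcm 1 (oneTo n)

_# : ℕ → ℕ
n # = product (filter prime? (oneTo n))

record NextPrime (n : ℕ) : Set where
  field
    value   : ℕ
    isPrime : Prime value
    greater : n < value
    least   : ∀ q → Prime q → n < q → value ≤ q

private
  primeDivisor : ∀ n → 1 < n → ∃[ p ] (Prime p × p ∣ n)
  primeDivisor n@(suc _) 1<n = go factors isFactorisation factorsPrime
    where
    open PrimeFactorisation (factorise n)
    go : ∀ ps → n ≡ product ps → All Prime ps → ∃[ p ] (Prime p × p ∣ n)
    go []       n≡1 _        = contradiction (sym n≡1) (<⇒≢ 1<n)
    go (p ∷ ps) n≡Π (pr ∷ _) =
      p , pr , divides (product ps) (trans n≡Π (*-comm p (product ps)))

  primeAbove : ∀ n → ∃[ p ] (Prime p × n < p)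
  primeAbove n with primeDivisor (n ! + 1) (+-monoˡ-≤ 1 (1≤n! n))
  ... | zero  , pr , _        = contradiction pr ¬prime[0]
  ... | suc p , pr , p∣n!+1 = suc p , pr , ≰⇒> λ p≤n →
    contradiction
      (subst Prime
        (∣1⇒≡1 (∣m+n∣m⇒∣n p∣n!+1 (∣-trans (m∣m*n (p !)) (m≤n⇒m!∣n! p≤n))))
        pr)
      ¬prime[1]

nextPrime : ∀ n → NextPrime n
nextPrime n with primeAbove n
... | p , pr , n<p =
  search (p ∸ suc n) (suc n) (n<1+n n) (λ _ _ n<q → n<q)
    (subst Prime (sym (m+[n∸m]≡n n<p)) pr)
  where
  search : ∀ k m → n < m → (∀ q → Prime q → n < q → m ≤ q) → Prime (m + k) → NextPrime n
  search zero    m n<m low pr′ = record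
    { value = m ; isPrime = subst Prime (+-identityʳ m) pr′ ; greater = n<m ; least = low }
  search (suc k) m n<m low pr′ with prime? m
  ... | yes pm = record { value = m ; isPrime = pm ; greater = n<m ; least = low }
  ... | no ¬pm = search k (suc m) (m<n⇒m<1+n n<m)
    (λ q pq n<q → ≤∧≢⇒< (low q pq n<q) λ m≡q → ¬pm (subst Prime (sym m≡q) pq))
    (subst Prime (+-suc m k) pr′)

-- nthPrime 1 = 2, nthPrime 2 = 3, …; the value at 0 only starts the recursion.
nthPrime : ℕ → ℕ
nthPrime zero    = 0
nthPrime (suc n) = NextPrime.value (nextPrime (nthPrime n))

-- p_n# as the product of the first n primes.
nthPrimorial : ℕ → ℕ
nthPrimorial n = product (map nthPrime (oneTo n))

data Kind : Set where
  factorial doubleFactorial lcmOfFirst primorial primePrimorial : Kind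

H : Kind → (A n : ℕ) → ℕ
H factorial       A n = A ^ n * n !
H doubleFactorial A n = A ^ n * n !!
H lcmOfFirst      A n = A ^ n * lcmUpTo n
H primorial       A n = A ^ n * n #
H primePrimorial  A n = A ^ nthPrime n * nthPrimorial n

∏H : ∀ {r} → (Fin r → Kind) → (Fin r → ℕ) → Vec ℕ r → ℕ
∏H kind A ns = product (tabulate λ i → H (kind i) (A i) (lookup ns i))

{-# OPTIONS --safe #-}
module Submission where

-- Let N be the largest of the n_i (for even double factorials n_i / 2, for p_n# the prime p_n).
-- If N is large, Bertrand's postulate gives a prime p with N / 2 < p ≤ N exceeding 2 and all A_i.
-- It divides the product, but each factor at most once, so its exponent there lies between 1 and
-- r < d, whereas in x^d it is a multiple of d. Hence N is bounded and only finitely many candidates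
-- remain. Bertrand's postulate, needed for large n only, is Erdős's argument: the primes in
-- (2n/3 , n] do not divide binom(2n, n) and every prime power dividing it is at most 2n, so without
-- primes in (n , 2n] it is at most (2n)^s * (2n/3)# with s about √(2n); as m# ≤ 4^m, this is less
-- than the lower bound 4^n / 2n.

open import Defs
open import Data.Fin.Base using (Fin; zero; suc)
open import Data.Integer.Base as ℤ using (ℤ) renaming (∣_∣ to abs)
import Data.Integer.Properties as ℤ
open import Data.List.Base using (List; []; _∷_; [_]; _++_; map; foldr; filter; upTo; tabulate; concatMap; cartesianProductWith)
open import Data.List.Membership.Propositional using (_∈_; find)
open import Data.List.Membership.Propositional.Properties using (∈-map⁺; ∈-map⁻; ∈-upTo⁺; ∈-upTo⁻; ∈-++⁺ˡ; ∈-++⁺ʳ; ∈-filter⁺; ∈-filter⁻; ∈-tabulate⁺; ∈-concatMap⁺; ∈-cartesianProductWith⁺)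
open import Data.List.Properties using (map-++; filter-++; filter-accept; filter-reject; upTo-∷ʳ)
open import Data.List.Relation.Unary.All as All using (All; []; _∷_)
import Data.List.Relation.Unary.All.Properties as All
open import Data.List.Relation.Unary.Any as Any using (Any; here; there)
open import Data.Nat.Base
open import Data.Nat.Combinatorics using (_C_; nCk≡n!/k![n-k]!; k![n∸k]!∣n!; nCk≡nC[n∸k]; nCk+nC[k+1]≡[n+1]C[k+1])
open import Data.Nat.Divisibility
open import Data.Nat.DivMod using (_/_; _%_; m/n*n≡m; m/n*n≤m; m%n<n; m≡m%n+[m/n]*n)
open import Data.Nat.Induction using (<-wellFounded)
open import Data.Nat.LCM using (lcm; m∣lcm[m,n]; n∣lcm[m,n]; lcm-least)
open import Data.Nat.ListAction using (product)
open import Data.Nat.ListAction.Properties using (product-++; ∈⇒∣product)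
open import Data.Nat.Primality
open import Data.Nat.Primality.Factorisation using (factorise)
open import Data.Nat.Properties
open import Data.Nat.Tactic.RingSolver using (solve-∀)
open import Data.Product.Base using (_×_; _,_; ∃-syntax; proj₁; proj₂)
open import Data.Sum.Base using (_⊎_; inj₁; inj₂; [_,_]′) renaming (map to map⊎)
open import Data.Vec.Base using (Vec; []; _∷_; lookup)
import Data.Vec.Relation.Unary.All as VecAll
import Data.Vec.Relation.Unary.All.Properties as VecAll
open import Function.Base using (_∘_)
open import Function.Bundles using (mk⇔)
open import Induction.WellFounded using (Acc; acc)
open import Relation.Binary.PropositionalEquality using (_≡_; refl; sym; trans; cong; cong₂; subst; subst₂; module ≡-Reasoning)
open import Relation.Nullary using (¬_; yes; no; contradiction; _×-dec_)
open import Relation.Unary using (Decidable)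

-- Divisibility by powers of a prime.

prime⇒1< : ∀ {p} → Prime p → 1 < p
prime⇒1< pp = nonTrivial⇒n>1 _ {{prime⇒nonTrivial pp}}

prime∤1 : ∀ {p} → Prime p → p ∤ 1
prime∤1 pp = >⇒∤ (prime⇒1< pp)

prime∤* : ∀ {p m n} → Prime p → p ∤ m → p ∤ n → p ∤ m * n
prime∤* {m = m} {n} pp p∤m p∤n p∣mn = [ p∤m , p∤n ]′ (euclidsLemma m n pp p∣mn)

prime∤^ : ∀ {p m} → Prime p → p ∤ m → ∀ k → p ∤ m ^ k
prime∤^ pp p∤m zero    = prime∤1 pp
prime∤^ pp p∤m (suc k) = prime∤* pp p∤m (prime∤^ pp p∤m k)

prime∣^⇒∣ : ∀ {p m} → Prime p → ∀ k → p ∣ m ^ k → p ∣ m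
prime∣^⇒∣ {p} {m} pp k p∣m^k with p ∣? m
... | yes p∣m = p∣m
... | no  p∤m = contradiction p∣m^k (prime∤^ pp p∤m k)

^-mono-∣ : ∀ {m n} k → m ∣ n → m ^ k ∣ n ^ k
^-mono-∣ zero    m∣n = ∣-refl
^-mono-∣ (suc k) m∣n = *-pres-∣ m∣n (^-mono-∣ k m∣n)

^-monoʳ-∣ : ∀ m {i j} → i ≤ j → m ^ i ∣ m ^ j
^-monoʳ-∣ m {i} {j} i≤j =
  subst (m ^ i ∣_) (trans (sym (^-distribˡ-+-* m i (j ∸ i))) (cong (m ^_) (m+[n∸m]≡n i≤j)))
    (m∣m*n (m ^ (j ∸ i)))

-- Induction on `k`: once `n` is `q * p ^ k`, cancelling `p ^ k` leaves `p ∣ m * q`, and Euclid's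
-- lemma moves the last `p` into `q`.
prime^-cancelˡ-∣ : ∀ {p m n} → Prime p → p ∤ m → ∀ k → p ^ k ∣ m * n → p ^ k ∣ n
prime^-cancelˡ-∣ pp p∤m zero _ = 1∣ _
prime^-cancelˡ-∣ {p} {m} {n} pp p∤m (suc k) p^∣mn
  with divides q refl ← prime^-cancelˡ-∣ {n = n} pp p∤m k (m*n∣⇒n∣ p (p ^ k) p^∣mn) =
  [ (λ p∣m → contradiction p∣m p∤m) , *-monoˡ-∣ (p ^ k) ]′ (euclidsLemma m q pp p∣mq)
  where
  instance
    _ = prime⇒nonZero pp
    _ = m^n≢0 p k
  p∣mq : p ∣ m * q
  p∣mq = *-cancelʳ-∣ (p ^ k) (subst (p * p ^ k ∣_) (sym (*-assoc m q (p ^ k))) p^∣mn)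

primePower-split : ∀ {p} → Prime p → ∀ n → .{{NonZero n}} →
                   ∃[ k ] ∃[ m ] (n ≡ p ^ k * m × p ∤ m)
primePower-split {p} pp n = go n (<-wellFounded n)
  where
  instance _ = prime⇒nonTrivial pp
  go : ∀ n → .{{NonZero n}} → Acc _<_ n → ∃[ k ] ∃[ m ] (n ≡ p ^ k * m × p ∤ m)
  go n (acc rs) with p ∣? n
  ... | no  p∤n = 0 , n , sym (*-identityˡ n) , p∤n
  ... | yes p∣n
    with k , m , q≡ , p∤m ← go (quotient p∣n) {{quotient≢0 p∣n}} (rs (quotient-< p∣n)) =
    suc k , m , trans (m∣n⇒n≡m*quotient p∣n) (trans (cong (p *_) q≡) (sym (*-assoc p (p ^ k) m))) , p∤m

-- With `a = p ^ i * a′` and `b = p ^ j * b′`, the lcm divides `p ^ l * a′ * b′` for `l` the larger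
-- of `i` and `j`. The part prime to `p` cancels, so `p ^ k` divides `p ^ l`, which divides `a` or
-- `b`.
prime^∣lcm⇒∣⊎∣ : ∀ {p} → Prime p → ∀ k a b → .{{NonZero a}} → .{{NonZero b}} →
                 p ^ k ∣ lcm a b → p ^ k ∣ a ⊎ p ^ k ∣ b
prime^∣lcm⇒∣⊎∣ {p} pp k a b p^k∣lcm
  with i , a′ , refl , p∤a′ ← primePower-split pp a
  with j , b′ , refl , p∤b′ ← primePower-split pp b
  = map⊎ (λ j≤i → ∣m⇒∣m*n a′ (bound i ∣-refl (^-monoʳ-∣ p j≤i)))
         (λ i≤j → ∣m⇒∣m*n b′ (bound j (^-monoʳ-∣ p i≤j) ∣-refl)) (≤-total j i)
  where
  eq₁ : ∀ u v w → u * v * w ≡ v * w * u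
  eq₁ = solve-∀
  eq₂ : ∀ u v w → u * w * v ≡ v * w * u
  eq₂ = solve-∀
  bound : ∀ l → p ^ i ∣ p ^ l → p ^ j ∣ p ^ l → p ^ k ∣ p ^ l
  bound l p^i∣ p^j∣ = prime^-cancelˡ-∣ pp (prime∤* pp p∤a′ p∤b′) k (∣-trans p^k∣lcm (lcm-least
    (subst (p ^ i * a′ ∣_) (eq₁ (p ^ l) a′ b′) (∣m⇒∣m*n b′ (*-monoˡ-∣ a′ p^i∣)))
    (subst (p ^ j * b′ ∣_) (eq₂ (p ^ l) a′ b′) (∣m⇒∣m*n a′ (*-monoˡ-∣ b′ p^j∣)))))

-- Prime powers in factorials.

prime∤! : ∀ {p n} → Prime p → n < p → p ∤ n !
prime∤! {n = zero}  pp _   = prime∤1 pp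
prime∤! {n = suc n} pp n<p = prime∤* pp (>⇒∤ n<p) (prime∤! pp (<-trans (n<1+n n) n<p))

m∣n! : ∀ {m n} → 0 < m → m ≤ n → m ∣ n !
m∣n! {suc m} _ m≤n = ∣-trans (m∣m*n (m !)) (m≤n⇒m!∣n! m≤n)

-- The factorial is descended factor by factor: a factor that is not a multiple of `p` cancels, and
-- a factor `suc q * p` costs exactly one `p` because `suc q < p`.
prime^∤[r+q*p]! : ∀ {p} → Prime p → ∀ q r → q < p → r < p → p ^ suc q ∤ (r + q * p) !
prime^∤[r+q*p]! {p} pp zero zero q<p r<p p∣ = prime∤1 pp (∣-trans (m∣m*n 1) p∣)
prime^∤[r+q*p]! {p@(suc p-1)} pp (suc q) zero q<p r<p p∣ =
  prime^∤[r+q*p]! pp q p-1 (<-trans (n<1+n q) q<p) (n<1+n p-1)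
    (prime^-cancelˡ-∣ pp (>⇒∤ q<p) (suc q)
      (*-cancelˡ-∣ p (subst (p ^ suc (suc q) ∣_) (eq p q ((p-1 + q * p) !)) p∣)))
  where
  eq : ∀ u v w → (u + v * u) * w ≡ u * (suc v * w)
  eq = solve-∀
prime^∤[r+q*p]! {p} pp q (suc r) q<p r<p p∣ =
  prime^∤[r+q*p]! pp q r q<p (<-trans (n<1+n r) r<p) (prime^-cancelˡ-∣ pp p∤ (suc q) p∣)
  where
  p∤ : p ∤ suc (r + q * p)
  p∤ p∣′ = >⇒∤ r<p
    (∣m+n∣m⇒∣n (subst (p ∣_) (+-comm (suc r) (q * p)) p∣′) (n∣m*n q))

prime^∤! : ∀ {p} → Prime p → ∀ q {n} → q < p → n < suc q * p → p ^ suc q ∤ n !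
prime^∤! {p@(suc p-1)} pp q {n} q<p n<[1+q]p p∣ =
  prime^∤[r+q*p]! pp q p-1 q<p (n<1+n p-1) (∣-trans p∣ (m≤n⇒m!∣n! (s≤s⁻¹ n<[1+q]p)))

-- Binomial coefficients.

-- Indexed by the two lower parts, which makes symmetry visible and avoids truncated subtraction and
-- the side condition `k ≤ n`.
binom : ℕ → ℕ → ℕ
binom a b = (a + b) C a

binom-! : ∀ a b → binom a b * (a ! * b !) ≡ (a + b) !
binom-! a b = subst (λ c → binom a b * (a ! * c !) ≡ (a + b) !) (m+n∸m≡n a b)
  (trans (cong (_* (a ! * (a + b ∸ a) !)) (nCk≡n!/k![n-k]! (m≤m+n a b)))
         (m/n*n≡m (k![n∸k]!∣n! (m≤m+n a b))))
  where instance _ = a !* (a + b ∸ a) !≢0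

binom≢0 : ∀ a b → NonZero (binom a b)
binom≢0 a b = ≢-nonZero λ B≡0 →
  ≢-nonZero⁻¹ ((a + b) !) {{(a + b) !≢0}} (trans (sym (binom-! a b)) (cong (_* (a ! * b !)) B≡0))

binom-comm : ∀ a b → binom a b ≡ binom b a
binom-comm a b = trans (nCk≡nC[n∸k] (m≤m+n a b)) (cong₂ _C_ (+-comm a b) (m+n∸m≡n a b))

binom-pascal : ∀ a b → binom (suc a) (suc b) ≡ binom a (suc b) + binom (suc a) b
binom-pascal a b = trans (sym (nCk+nC[k+1]≡[n+1]C[k+1] (a + suc b) a))
  (cong (λ n → binom a (suc b) + n C suc a) (+-suc a b))

binom-sucʳ : ∀ a b → suc b * binom a (suc b) ≡ suc (a + b) * binom a b
binom-sucʳ a b = *-cancelʳ-≡ _ _ (a ! * b !) (begin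
  suc b * binom a (suc b) * (a ! * b !)  ≡⟨ eq (suc b) (binom a (suc b)) (a !) (b !) ⟩
  binom a (suc b) * (a ! * suc b !)      ≡⟨ binom-! a (suc b) ⟩
  (a + suc b) !                          ≡⟨ cong _! (+-suc a b) ⟩
  suc (a + b) * (a + b) !                ≡⟨ cong (suc (a + b) *_) (binom-! a b) ⟨
  suc (a + b) * (binom a b * (a ! * b !)) ≡⟨ *-assoc (suc (a + b)) (binom a b) (a ! * b !) ⟨
  suc (a + b) * binom a b * (a ! * b !)  ∎)
  where
  open ≡-Reasoning
  instance _ = a !* b !≢0
  eq : ∀ u v w x → u * v * (w * x) ≡ v * (w * (u * x))
  eq = solve-∀

binom-sucˡ : ∀ a b → suc a * binom (suc a) b ≡ suc (a + b) * binom a b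
binom-sucˡ a b = begin
  suc a * binom (suc a) b ≡⟨ cong (suc a *_) (binom-comm (suc a) b) ⟩
  suc a * binom b (suc a) ≡⟨ binom-sucʳ b a ⟩
  suc (b + a) * binom b a ≡⟨ cong₂ (λ n B → suc n * B) (+-comm b a) (binom-comm b a) ⟩
  suc (a + b) * binom a b ∎
  where open ≡-Reasoning

binom-zeroʳ : ∀ a → binom a 0 ≡ 1
binom-zeroʳ a = binom-comm a 0

-- Pascal's rule doubles the bound from row to row. It is half the row sum, which holds from row 1
-- on, hence the `suc a`.
binom[1+a,b]≤2^ : ∀ a b → binom (suc a) b ≤ 2 ^ (a + b)
binom[1+a,b]≤2^ a zero = subst (_≤ 2 ^ (a + 0)) (sym (binom-zeroʳ (suc a))) (m^n>0 2 (a + 0))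
binom[1+a,b]≤2^ a (suc b) = begin
  binom (suc a) (suc b)           ≡⟨ binom-pascal a b ⟩
  binom a (suc b) + binom (suc a) b ≤⟨ +-mono-≤ (bound a) (binom[1+a,b]≤2^ a b) ⟩
  2 ^ (a + b) + 2 ^ (a + b)       ≡⟨ cong (2 ^ (a + b) +_) (+-identityʳ (2 ^ (a + b))) ⟨
  2 ^ suc (a + b)                 ≡⟨ cong (2 ^_) (+-suc a b) ⟨
  2 ^ (a + suc b)                 ∎
  where
  open ≤-Reasoning
  bound : ∀ a → binom a (suc b) ≤ 2 ^ (a + b)
  bound zero    = m^n>0 2 b
  bound (suc a) = subst (λ n → binom (suc a) (suc b) ≤ 2 ^ n) (+-suc a b) (binom[1+a,b]≤2^ a (suc b))

2^[m+m]≡4^m : ∀ m → 2 ^ (m + m) ≡ 4 ^ m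
2^[m+m]≡4^m m = trans (cong (λ n → 2 ^ (m + n)) (sym (+-identityʳ m))) (sym (^-*-assoc 2 2 m))

binom[m,m]≤4^m : ∀ m → binom m m ≤ 4 ^ m
binom[m,m]≤4^m zero    = ≤-refl
binom[m,m]≤4^m (suc m) = begin
  binom (suc m) (suc m) ≤⟨ binom[1+a,b]≤2^ m (suc m) ⟩
  2 ^ (m + suc m)       ≤⟨ ^-monoʳ-≤ 2 (n≤1+n (m + suc m)) ⟩
  2 ^ (suc m + suc m)   ≡⟨ 2^[m+m]≡4^m (suc m) ⟩
  4 ^ suc m             ∎
  where open ≤-Reasoning

binom-central : ∀ m → binom (suc m) (suc m) ≡ 2 * binom (suc m) m
binom-central m = begin
  binom (suc m) (suc m)             ≡⟨ binom-pascal m m ⟩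
  binom m (suc m) + binom (suc m) m ≡⟨ cong (_+ binom (suc m) m) (binom-comm m (suc m)) ⟩
  binom (suc m) m + binom (suc m) m ≡⟨ cong (binom (suc m) m +_) (+-identityʳ _) ⟨
  2 * binom (suc m) m               ∎
  where open ≡-Reasoning

binom[1+m,m]≤4^m : ∀ m → binom (suc m) m ≤ 4 ^ m
binom[1+m,m]≤4^m m = *-cancelˡ-≤ 2 (begin
  2 * binom (suc m) m   ≡⟨ binom-central m ⟨
  binom (suc m) (suc m) ≤⟨ binom[1+a,b]≤2^ m (suc m) ⟩
  2 ^ (m + suc m)       ≡⟨ cong (2 ^_) (+-suc m m) ⟩
  2 * 2 ^ (m + m)       ≡⟨ cong (2 *_) (2^[m+m]≡4^m m) ⟩
  2 * 4 ^ m             ∎)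
  where open ≤-Reasoning

binom-central-suc : ∀ n → suc n * binom (suc n) (suc n) ≡ 2 * suc (n + n) * binom n n
binom-central-suc n = begin
  suc n * binom (suc n) (suc n)     ≡⟨ cong (suc n *_) (binom-central n) ⟩
  suc n * (2 * binom (suc n) n)     ≡⟨ eq (suc n) (binom (suc n) n) ⟩
  2 * (suc n * binom (suc n) n)     ≡⟨ cong (2 *_) (binom-sucˡ n n) ⟩
  2 * (suc (n + n) * binom n n)     ≡⟨ *-assoc 2 (suc (n + n)) (binom n n) ⟨
  2 * suc (n + n) * binom n n       ∎
  where
  open ≡-Reasoning
  eq : ∀ u v → u * (2 * v) ≡ 2 * (u * v)
  eq = solve-∀

-- By `binom-central-suc`, `n * binom n n` grows at least fourfold at each step, and `n = 1` gives
-- equality.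
4^n≤2n*binom : ∀ n → .{{NonZero n}} → 4 ^ n ≤ 2 * n * binom n n
4^n≤2n*binom 1             = ≤-refl
4^n≤2n*binom (suc n@(suc _)) = begin
  4 * 4 ^ n                             ≤⟨ *-monoʳ-≤ 4 (4^n≤2n*binom n) ⟩
  4 * (2 * n * binom n n)               ≤⟨ *-monoʳ-≤ 4 (*-monoˡ-≤ (binom n n) (≤-trans (≤-reflexive (eq₁ n)) (n≤1+n (n + n)))) ⟩
  4 * (suc (n + n) * binom n n)         ≡⟨ eq₂ (suc (n + n)) (binom n n) ⟩
  2 * (2 * suc (n + n) * binom n n)     ≡⟨ cong (2 *_) (binom-central-suc n) ⟨
  2 * (suc n * binom (suc n) (suc n))   ≡⟨ *-assoc 2 (suc n) (binom (suc n) (suc n)) ⟨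
  2 * suc n * binom (suc n) (suc n)     ∎
  where
  open ≤-Reasoning
  eq₁ : ∀ n → 2 * n ≡ n + n
  eq₁ = solve-∀
  eq₂ : ∀ u v → 4 * (u * v) ≡ 2 * (2 * u * v)
  eq₂ = solve-∀

-- The numbers D a b = (a + b + 1) * binom a b are the denominators of Leibniz's harmonic
-- triangle: 1 / D a (b + 1) = 1 / D a b - 1 / D (a + 1) b.
leibniz∣commonMultiple : ∀ {M} a b → (∀ {i} → 0 < i → i ≤ suc (a + b) → i ∣ M) →
                         suc (a + b) * binom a b ∣ M
leibniz∣commonMultiple {M} a zero mult =
  subst (_∣ M) (sym (trans (cong (suc (a + 0) *_) (binom-zeroʳ a)) (*-identityʳ _))) (mult z<s ≤-refl)
leibniz∣commonMultiple {M} a (suc b) mult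
  with divides x M≡x ← leibniz∣commonMultiple {M} a b
         (λ {i} 0<i i≤ → mult 0<i (m≤n⇒m≤1+n (subst (i ≤_) (sym (+-suc a b)) i≤)))
     | divides y M≡y ← leibniz∣commonMultiple {M} (suc a) b
         (λ {i} 0<i i≤ → mult 0<i (subst (λ n → i ≤ suc n) (sym (+-suc a b)) i≤)) =
  divides (x ∸ y) (begin
    M                                      ≡⟨ M≡x ⟩
    x * (suc (a + b) * binom a b)          ≡⟨ cong (x *_) (binom-sucʳ a b) ⟨
    x * (suc b * B)                        ≡⟨ m+n∸m≡n (x * suc a * B) _ ⟨
    x * suc a * B + x * (suc b * B) ∸ x * suc a * B
      ≡⟨ cong₂ _∸_ (eq₁ x a b B) (trans (cong (_* B) xa≡yc) (eq₂ y a b B)) ⟩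
    x * (suc (a + suc b) * B) ∸ y * (suc (a + suc b) * B)
      ≡⟨ *-distribʳ-∸ (suc (a + suc b) * B) x y ⟨
    (x ∸ y) * (suc (a + suc b) * B)        ∎)
  where
  open ≡-Reasoning
  B = binom a (suc b)
  instance _ = binom≢0 (suc a) b
  xa≡yc : x * suc a ≡ y * suc (suc a + b)
  xa≡yc = *-cancelʳ-≡ _ _ (binom (suc a) b) (begin
    x * suc a * binom (suc a) b              ≡⟨ *-assoc x (suc a) (binom (suc a) b) ⟩
    x * (suc a * binom (suc a) b)            ≡⟨ cong (x *_) (binom-sucˡ a b) ⟩
    x * (suc (a + b) * binom a b)            ≡⟨ M≡x ⟨
    M                                        ≡⟨ M≡y ⟩
    y * (suc (suc a + b) * binom (suc a) b)  ≡⟨ *-assoc y _ (binom (suc a) b) ⟨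
    y * suc (suc a + b) * binom (suc a) b    ∎)
  eq₁ : ∀ x a b B → x * suc a * B + x * (suc b * B) ≡ x * (suc (a + suc b) * B)
  eq₁ = solve-∀
  eq₂ : ∀ y a b B → y * suc (suc a + b) * B ≡ y * (suc (a + suc b) * B)
  eq₂ = solve-∀

-- The least common multiple of 1, ..., n and prime powers in central binomial coefficients.

∈-oneTo : ∀ {i n} → 0 < i → i ≤ n → i ∈ oneTo n
∈-oneTo {suc i} _ i<n = ∈-map⁺ suc (∈-upTo⁺ i<n)

oneTo-nonZero : ∀ n → All NonZero (oneTo n)
oneTo-nonZero n = All.map⁺ (All.universal (λ _ → _) (upTo n))

oneTo-suc : ∀ n → oneTo (suc n) ≡ oneTo n ++ [ suc n ]
oneTo-suc n = trans (cong (map suc) (sym (upTo-∷ʳ n))) (map-++ suc (upTo n) [ n ])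

∣foldr-lcm : ∀ {x xs} → x ∈ xs → x ∣ foldr lcm 1 xs
∣foldr-lcm {xs = x ∷ xs} (here refl) = m∣lcm[m,n] x (foldr lcm 1 xs)
∣foldr-lcm {xs = y ∷ xs} (there x∈)  = ∣-trans (∣foldr-lcm x∈) (n∣lcm[m,n] y (foldr lcm 1 xs))

∣lcmUpTo : ∀ {i n} → 0 < i → i ≤ n → i ∣ lcmUpTo n
∣lcmUpTo 0<i i≤n = ∣foldr-lcm (∈-oneTo 0<i i≤n)

lcm≢0 : ∀ m n → .{{NonZero m}} → .{{NonZero n}} → NonZero (lcm m n)
lcm≢0 m n = ≢-nonZero λ lcm≡0 → ≢-nonZero⁻¹ (m * n) {{m*n≢0 m n}}
  (0∣⇒≡0 (subst (_∣ m * n) lcm≡0 (lcm-least {m} {n} (m∣m*n n) (n∣m*n m))))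

foldr-lcm≢0 : ∀ {xs} → All NonZero xs → NonZero (foldr lcm 1 xs)
foldr-lcm≢0 []            = _
foldr-lcm≢0 (x≢0 ∷ xs≢0) = lcm≢0 _ _ {{x≢0}} {{foldr-lcm≢0 xs≢0}}

prime^∣foldr-lcm : ∀ {p} → Prime p → ∀ k {xs} → All NonZero xs →
                   p ^ k ∣ foldr lcm 1 xs → p ^ k ∣ 1 ⊎ Any (p ^ k ∣_) xs
prime^∣foldr-lcm pp k []            p^k∣ = inj₁ p^k∣
prime^∣foldr-lcm pp k (x≢0 ∷ xs≢0) p^k∣
  with prime^∣lcm⇒∣⊎∣ pp k _ _ {{x≢0}} {{foldr-lcm≢0 xs≢0}} p^k∣
... | inj₁ p^k∣x  = inj₂ (here p^k∣x)
... | inj₂ p^k∣xs = map⊎ (λ d → d) there (prime^∣foldr-lcm pp k xs≢0 p^k∣xs)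

prime^∣lcmUpTo⇒≤ : ∀ {p} → Prime p → ∀ k {n} → .{{NonZero n}} → p ^ k ∣ lcmUpTo n → p ^ k ≤ n
prime^∣lcmUpTo⇒≤ pp k {n} p^k∣ with prime^∣foldr-lcm pp k (oneTo-nonZero n) p^k∣
... | inj₁ p^k∣1 = ≤-trans (∣⇒≤ p^k∣1) (>-nonZero⁻¹ n)
... | inj₂ any with find any
...   | x , x∈ , p^k∣x with ∈-map⁻ suc x∈
...     | y , y∈ , refl = ≤-trans (∣⇒≤ p^k∣x) (∈-upTo⁻ y∈)

-- For `n = suc m`, `n * binom n n` is the Leibniz denominator `suc (n + m) * binom n m`. So it
-- divides `lcmUpTo (n + n)`, whose prime power divisors are at most `n + n`. This takes the place
-- of Legendre's formula.
prime^∣binom⇒≤ : ∀ {p} → Prime p → ∀ k n → .{{NonZero n}} → p ^ k ∣ binom n n → p ^ k ≤ n + n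
prime^∣binom⇒≤ {p} pp k n@(suc m) p^k∣ = prime^∣lcmUpTo⇒≤ pp k (begin
  p ^ k                       ∣⟨ p^k∣ ⟩
  binom n n                   ∣⟨ n∣m*n n ⟩
  n * binom n n               ≡⟨ binom-sucʳ n m ⟩
  suc (n + m) * binom n m     ∣⟨ leibniz∣commonMultiple n m
                                   (λ {i} 0<i i≤ → ∣lcmUpTo 0<i (subst (i ≤_) (sym (+-suc n m)) i≤)) ⟩
  lcmUpTo (n + n)             ∎)
  where open ∣-Reasoning

-- Primorials and their upper bound.

#-suc : ∀ n → suc n # ≡ n # * product (filter prime? [ suc n ])
#-suc n = begin
  suc n #                                              ≡⟨ cong (product ∘ filter prime?) (oneTo-suc n) ⟩
  product (filter prime? (oneTo n ++ [ suc n ]))       ≡⟨ cong product (filter-++ prime? (oneTo n) [ suc n ]) ⟩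
  product (filter prime? (oneTo n) ++ filter prime? [ suc n ])
    ≡⟨ product-++ (filter prime? (oneTo n)) (filter prime? [ suc n ]) ⟩
  n # * product (filter prime? [ suc n ])              ∎
  where open ≡-Reasoning

#-suc-prime : ∀ {n} → Prime (suc n) → suc n # ≡ suc n * n #
#-suc-prime {n} pr = begin
  suc n #                                 ≡⟨ #-suc n ⟩
  n # * product (filter prime? [ suc n ]) ≡⟨ cong (λ qs → n # * product qs) (filter-accept prime? pr) ⟩
  n # * (suc n * 1)                       ≡⟨ cong (n # *_) (*-identityʳ (suc n)) ⟩
  n # * suc n                             ≡⟨ *-comm (n #) (suc n) ⟩
  suc n * n #                             ∎
  where open ≡-Reasoning

#-suc-¬prime : ∀ {n} → ¬ Prime (suc n) → suc n # ≡ n #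
#-suc-¬prime {n} ¬pr = trans (#-suc n)
  (trans (cong (λ qs → n # * product qs) (filter-reject prime? ¬pr)) (*-identityʳ (n #)))

#≢0 : ∀ n → NonZero (n #)
#≢0 zero    = _
#≢0 (suc n) with prime? (suc n)
... | yes pr = subst NonZero (sym (#-suc-prime pr)) (m*n≢0 (suc n) (n #) {{_}} {{#≢0 n}})
... | no ¬pr = subst NonZero (sym (#-suc-¬prime ¬pr)) (#≢0 n)

n#≤[1+n]# : ∀ n → n # ≤ suc n #
n#≤[1+n]# n with prime? (suc n)
... | yes pr = ≤-trans (m≤n*m (n #) (suc n)) (≤-reflexive (sym (#-suc-prime pr)))
... | no ¬pr = ≤-reflexive (sym (#-suc-¬prime ¬pr))

prime∤# : ∀ {p n} → Prime p → n < p → p ∤ n #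
prime∤# {n = zero}  pp _   = prime∤1 pp
prime∤# {p} {suc n} pp n<p with prime? (suc n)
... | yes pr = subst (p ∤_) (sym (#-suc-prime pr)) (prime∤* pp (>⇒∤ n<p) (prime∤# pp (<-trans (n<1+n n) n<p)))
... | no ¬pr = subst (p ∤_) (sym (#-suc-¬prime ¬pr)) (prime∤# pp (<-trans (n<1+n n) n<p))

-- Distinct primes dividing `M` divide it jointly. In the induction `a # * M` is `c * (k + a) #`; a
-- new prime `suc (k + a)` divides this product but not `(k + a) #`, hence divides `c`.
[k+a]#∣a#*M : ∀ {M} a k → (∀ {q} → Prime q → a < q → q ≤ k + a → q ∣ M) → (k + a) # ∣ a # * M
[k+a]#∣a#*M {M} a zero    q∣M = m∣m*n M
[k+a]#∣a#*M {M} a (suc k) q∣M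
  with ih@(divides c a#M≡) ← [k+a]#∣a#*M {M} a k (λ pq a<q q≤ → q∣M pq a<q (m≤n⇒m≤1+n q≤))
  with prime? (suc (k + a))
... | no ¬pr = subst (_∣ a # * M) (sym (#-suc-¬prime ¬pr)) ih
... | yes pr = subst₂ _∣_ (sym (#-suc-prime pr)) (sym a#M≡) (*-monoˡ-∣ ((k + a) #)
    ([ (λ q∣c → q∣c) , (λ q∣ → contradiction q∣ (prime∤# pr (n<1+n (k + a)))) ]′
      (euclidsLemma c ((k + a) #) pr (subst (suc (k + a) ∣_) a#M≡
        (∣n⇒∣m*n (a #) (q∣M pr (s≤s (m≤n+m a k)) ≤-refl))))))

-- A prime in `(a , b + a]` divides `(a + b) !` but, as `b ≤ a`, neither `a !` nor `b !`, so it
-- divides `binom a b`.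
[b+a]#≤a#*binom : ∀ {a b} → b ≤ a → (b + a) # ≤ a # * binom a b
[b+a]#≤a#*binom {a} {b} b≤a = ∣⇒≤ ([k+a]#∣a#*M a b q∣binom)
  where
  instance _ = m*n≢0 (a #) (binom a b) {{#≢0 a}} {{binom≢0 a b}}
  q∣binom : ∀ {q} → Prime q → a < q → q ≤ b + a → q ∣ binom a b
  q∣binom {q} pq a<q q≤b+a =
    [ (λ q∣ → q∣)
    , (λ q∣ → contradiction q∣ (prime∤* pq (prime∤! pq a<q) (prime∤! pq (≤-<-trans b≤a a<q)))) ]′
    (euclidsLemma (binom a b) (a ! * b !) pq (subst (q ∣_) (sym (binom-! a b))
      (m∣n! (<-trans z<s (prime⇒1< pq)) (subst (q ≤_) (+-comm b a) q≤b+a))))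

even⊎odd : ∀ n → ∃[ m ] (n ≡ m + m ⊎ n ≡ m + suc m)
even⊎odd zero    = 0 , inj₁ refl
even⊎odd (suc n) with even⊎odd n
... | m , inj₁ refl = m , inj₂ (sym (+-suc m m))
... | m , inj₂ refl = suc m , inj₁ refl

-- Strong induction by halving: `m + m` reduces to `m`, and `m + suc m` to `suc m`. In both cases
-- the primes above are absorbed by a binomial coefficient of size at most `4 ^ m`.
n#≤4^n : ∀ n → n # ≤ 4 ^ n
n#≤4^n n = go n (<-wellFounded n)
  where
  open ≤-Reasoning
  go : ∀ n → Acc _<_ n → n # ≤ 4 ^ n
  go n (acc rs) with even⊎odd n
  ... | zero      , inj₁ refl = ≤-refl
  ... | zero      , inj₂ refl = s≤s z≤n
  ... | m@(suc _) , inj₁ refl = begin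
    (m + m) #       ≤⟨ [b+a]#≤a#*binom {m} ≤-refl ⟩
    m # * binom m m ≤⟨ *-mono-≤ (go m (rs (m<m+n m z<s))) (binom[m,m]≤4^m m) ⟩
    4 ^ m * 4 ^ m   ≡⟨ ^-distribˡ-+-* 4 m m ⟨
    4 ^ (m + m)     ∎
  ... | m@(suc _) , inj₂ refl = begin
    (m + suc m) #               ≤⟨ [b+a]#≤a#*binom (n≤1+n m) ⟩
    suc m # * binom (suc m) m   ≤⟨ *-mono-≤ (go (suc m) (rs (m<n+m (suc m) z<s))) (binom[1+m,m]≤4^m m) ⟩
    4 ^ suc m * 4 ^ m           ≡⟨ *-comm (4 ^ suc m) (4 ^ m) ⟩
    4 ^ m * 4 ^ suc m           ≡⟨ ^-distribˡ-+-* 4 m (suc m) ⟨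
    4 ^ (m + suc m)             ∎

-- Bounding a number through the prime powers dividing it.

noPrimeDivisor⇒≡1 : ∀ n → .{{NonZero n}} → (∀ {p} → Prime p → p ∤ n) → n ≡ 1
noPrimeDivisor⇒≡1 n p∤n with factorise n
... | record { factors = [] ; isFactorisation = n≡1 } = n≡1
... | record { factors = p ∷ ps ; isFactorisation = n≡ ; factorsPrime = pp ∷ _ } =
  contradiction (subst (p ∣_) (sym n≡) (m∣m*n (product ps))) (p∤n pp)

-- Peel off the prime powers exactly dividing n one prime at a time, from the largest prime down.
primePowers-bound : (G : ℕ → ℕ) → 1 ≤ G 0 → (∀ t → G t ≤ G (suc t)) →
                    ∀ t n → .{{NonZero n}} → (∀ {p} → Prime p → p ∣ n → p ≤ t) →
                    (∀ {u} k → Prime (suc u) → suc u ^ k ∣ n → suc u ^ k * G u ≤ G (suc u)) →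
                    n ≤ G t
primePowers-bound G 1≤G₀ G-mono zero n p≤0 step =
  subst (_≤ G 0) (sym (noPrimeDivisor⇒≡1 n λ pp p∣n →
    contradiction (p≤0 pp p∣n) (<⇒≱ (<-trans z<s (prime⇒1< pp))))) 1≤G₀
primePowers-bound G 1≤G₀ G-mono (suc t) n p≤1+t step with prime? (suc t)
... | no ¬pr = ≤-trans (primePowers-bound G 1≤G₀ G-mono t n
        (λ pp p∣n → s≤s⁻¹ (≤∧≢⇒< (p≤1+t pp p∣n) λ { refl → ¬pr pp })) step) (G-mono t)
... | yes pr with k , m , refl , p∤m ← primePower-split pr n =
  ≤-trans (*-monoʳ-≤ (suc t ^ k) m≤Gt) (step k pr (m∣m*n m))
  where
  m≤Gt : m ≤ G t
  m≤Gt = primePowers-bound G 1≤G₀ G-mono t m {{m*n≢0⇒n≢0 (suc t ^ k)}}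
    (λ pp p∣m → s≤s⁻¹ (≤∧≢⇒< (p≤1+t pp (∣n⇒∣m*n (suc t ^ k) p∣m)) λ { refl → p∤m p∣m }))
    (λ j pu u^j∣m → step j pu (∣n⇒∣m*n (suc t ^ k) u^j∣m))

-- Primes up to s contribute at most b each, the larger ones at most themselves.
primePowers-bound-# : ∀ b s t n → .{{NonZero b}} → .{{NonZero n}} → b < suc s * suc s →
                      (∀ {p} → Prime p → p ∣ n → p ≤ t) →
                      (∀ {p} k → Prime p → p ^ k ∣ n → p ^ k ≤ b) →
                      n ≤ b ^ s * t #
primePowers-bound-# b s t n b<[1+s]² p≤t p^k≤b = ≤-trans
  (primePowers-bound G ≤-refl (λ u → *-mono-≤ (^-monoʳ-≤ b (⊓-monoˡ-≤ s (n≤1+n u))) (n#≤[1+n]# u)) t n p≤t step)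
  (*-monoˡ-≤ (t #) (^-monoʳ-≤ b (m⊓n≤n t s)))
  where
  open ≤-Reasoning
  G : ℕ → ℕ
  -- Up to `s` the power of `b` pays for a prime power; beyond `s` the growth of `u #` pays for a
  -- single prime.
  G u = b ^ (u ⊓ s) * u #
  eq : ∀ x y z → x * (y * z) ≡ y * (x * z)
  eq = solve-∀
  step : ∀ {u} k → Prime (suc u) → suc u ^ k ∣ n → suc u ^ k * G u ≤ G (suc u)
  step {u} k pr u^k∣n with suc u ≤? s
  ... | yes u<s = begin
    suc u ^ k * (b ^ (u ⊓ s) * u #)  ≤⟨ *-mono-≤ (p^k≤b k pr u^k∣n) (*-monoʳ-≤ (b ^ (u ⊓ s)) (n#≤[1+n]# u)) ⟩
    b * (b ^ (u ⊓ s) * suc u #)      ≡⟨ *-assoc b _ _ ⟨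
    b * b ^ (u ⊓ s) * suc u #        ≡⟨ cong (λ v → b * b ^ v * suc u #) (m≤n⇒m⊓n≡m (<⇒≤ u<s)) ⟩
    b ^ suc u * suc u #              ≡⟨ cong (λ v → b ^ v * suc u #) (m≤n⇒m⊓n≡m u<s) ⟨
    b ^ (suc u ⊓ s) * suc u #        ∎
  ... | no u≮s = begin
    suc u ^ k * (b ^ (u ⊓ s) * u #)  ≤⟨ *-monoˡ-≤ _ (u^k≤u k u^k∣n) ⟩
    suc u * (b ^ (u ⊓ s) * u #)      ≡⟨ eq (suc u) (b ^ (u ⊓ s)) (u #) ⟩
    b ^ (u ⊓ s) * (suc u * u #)      ≡⟨ cong (b ^ (u ⊓ s) *_) (#-suc-prime pr) ⟨
    b ^ (u ⊓ s) * suc u #            ≤⟨ *-monoˡ-≤ (suc u #) (^-monoʳ-≤ b (⊓-monoˡ-≤ s (n≤1+n u))) ⟩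
    b ^ (suc u ⊓ s) * suc u #        ∎
    where
    s<u : suc s ≤ suc u
    s<u = ≰⇒> u≮s
    u^k≤u : ∀ k → suc u ^ k ∣ n → suc u ^ k ≤ suc u
    u^k≤u zero          _     = s≤s z≤n
    u^k≤u (suc zero)    _     = ≤-reflexive (*-identityʳ (suc u))
    -- The square of a prime beyond `s` is at least `suc s * suc s`, which already exceeds `b`.
    u^k≤u (suc (suc k)) u^k∣n = contradiction (p^k≤b 2 pr (∣-trans (^-monoʳ-∣ (suc u) {2} {2+ k} (s≤s (s≤s z≤n))) u^k∣n))
      (<⇒≱ (<-≤-trans b<[1+s]² (≤-trans (*-mono-≤ s<u s<u)
        (≤-reflexive (cong (suc u *_) (sym (*-identityʳ (suc u))))))))

-- Bertrand's postulate for large n.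

∃-log₄ : ∀ n → .{{NonZero n}} → ∃[ e ] (4 ^ e ≤ n × n < 4 ^ suc e)
∃-log₄ 1             = 0 , ≤-refl , s≤s (s≤s z≤n)
∃-log₄ (suc n@(suc _)) with ∃-log₄ n
... | e , 4^e≤n , n<4^[1+e] with suc n <? 4 ^ suc e
...   | yes 1+n<4^[1+e] = e , m≤n⇒m≤1+n 4^e≤n , 1+n<4^[1+e]
...   | no  1+n≮4^[1+e] = suc e , ≮⇒≥ 1+n≮4^[1+e] ,
        ≤-<-trans n<4^[1+e] (^-monoʳ-< 4 (s≤s (s≤s z≤n)) (n<1+n (suc e)))

-- Contradicts the conclusion of `noPrimes⇒2^e≤24e`. The offset is 8 because the inequality still
-- fails at 7, where 168 exceeds 128.
24*[8+e]<2^[8+e] : ∀ e → 24 * (8 + e) < 2 ^ (8 + e)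
24*[8+e]<2^[8+e] zero    = <ᵇ⇒< 192 256 _
24*[8+e]<2^[8+e] (suc e) = begin-strict
  24 * (8 + suc e)            ≡⟨ eq e ⟩
  24 + 24 * (8 + e)           ≤⟨ +-monoˡ-≤ (24 * (8 + e)) (m≤m*n 24 (8 + e)) ⟩
  24 * (8 + e) + 24 * (8 + e) <⟨ +-mono-< (24*[8+e]<2^[8+e] e) (24*[8+e]<2^[8+e] e) ⟩
  2 ^ (8 + e) + 2 ^ (8 + e)   ≡⟨ cong (2 ^ (8 + e) +_) (+-identityʳ (2 ^ (8 + e))) ⟨
  2 ^ suc (8 + e)             ≡⟨ cong (2 ^_) (+-suc 8 e) ⟨
  2 ^ (8 + suc e)             ∎
  where
  open ≤-Reasoning
  eq : ∀ e → 24 * (8 + suc e) ≡ 24 + 24 * (8 + e)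
  eq = solve-∀

-- A prime divisor `p` of `binom n n` is at most `n + n`, hence at most `n` by assumption. If also
-- `m < p`, then `p` divides `binom n n` and both copies of `n !`, so `p ^ 3` divides `(n + n) !`,
-- although `n + n < 3 * p`.
noPrimes⇒binom-bound : ∀ n s m → .{{NonZero n}} → 2 < n → n + n < suc s * suc s → n + n < 3 * suc m →
                       (∀ {q} → Prime q → n < q → n + n < q) →
                       binom n n ≤ (n + n) ^ s * m #
noPrimes⇒binom-bound n s m 2<n 2n<[1+s]² 2n<3[1+m] noPrime =
  primePowers-bound-# (n + n) s m (binom n n) {{>-nonZero (<-≤-trans (>-nonZero⁻¹ n) (m≤m+n n n))}} {{binom≢0 n n}}
    2n<[1+s]² p≤m (λ k pp → prime^∣binom⇒≤ pp k n)
  where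
  p≤m : ∀ {p} → Prime p → p ∣ binom n n → p ≤ m
  p≤m {p} pp p∣B = ≮⇒≥ λ m<p →
    let 2n<3p = <-≤-trans 2n<3[1+m] (*-monoʳ-≤ 3 m<p) in
    prime^∤! pp 2 (2<p 2n<3p) 2n<3p p³∣[2n]!
    where
    p≤n : p ≤ n
    p≤n = ≮⇒≥ λ n<p → contradiction
      (subst (_≤ n + n) (*-identityʳ p) (prime^∣binom⇒≤ pp 1 n (subst (_∣ binom n n) (sym (*-identityʳ p)) p∣B)))
      (<⇒≱ (noPrime pp n<p))
    -- `prime^∤!` with `q = 2` needs `2 < p`; this follows from 6 ≤ 2n < 3p.
    2<p : n + n < 3 * p → 2 < p
    2<p 2n<3p = *-cancelˡ-< 3 2 p (≤-<-trans (+-mono-≤ 2<n 2<n) 2n<3p)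
    p∣n! : p ∣ n !
    p∣n! = m∣n! (<-trans z<s (prime⇒1< pp)) p≤n
    p³∣[2n]! : p ^ 3 ∣ (n + n) !
    p³∣[2n]! = subst₂ _∣_ (cong (λ q → p * (p * q)) (sym (*-identityʳ p))) (binom-! n n)
      (*-pres-∣ p∣B (*-pres-∣ p∣n! p∣n!))

-- Write t = 2^e. Both bounds on `binom n n` give 4^n ≤ (2n)^t m# ≤ 4^(et + m), so n ≤ et + m. As 3m
-- ≤ 2n, this yields n ≤ 3et, and then t² = 4^e ≤ 8n ≤ 24et.
noPrimes⇒2^e≤24e : ∀ n e → 2 < n → 4 ^ e ≤ 4 * (n + n) → n + n < 4 ^ e →
                   (∀ {q} → Prime q → n < q → n + n < q) → 2 ^ e ≤ 24 * e
noPrimes⇒2^e≤24e n e 2<n 4^e≤8n 2n<4^e noPrime = *-cancelʳ-≤ (2 ^ e) (24 * e) (2 ^ e) (begin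
  2 ^ e * 2 ^ e             ≡⟨ 2^*2^≡4^ ⟩
  4 ^ e                     ≤⟨ 4^e≤8n ⟩
  4 * (n + n)               ≤⟨ *-monoʳ-≤ 4 (+-mono-≤ n≤3et n≤3et) ⟩
  4 * (3 * (e * t) + 3 * (e * t)) ≡⟨ eq₁ e t ⟩
  24 * e * 2 ^ e            ∎)
  where
  open ≤-Reasoning
  t = 2 ^ e
  -- So `suc s * suc s` is `4 ^ e`, above `n + n`; the factor `n + n` of the lower bound raises the
  -- exponent `s` to `t`.
  s = pred t
  m = (n + n) / 3
  instance
    t≢0 = m^n≢0 2 e
    n≢0 = >-nonZero (<-trans z<s 2<n)
  2^*2^≡4^ : 2 ^ e * 2 ^ e ≡ 4 ^ e
  2^*2^≡4^ = trans (sym (^-distribˡ-+-* 2 e e)) (2^[m+m]≡4^m e)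
  eq₁ : ∀ e t → 4 * (3 * (e * t) + 3 * (e * t)) ≡ 24 * e * t
  eq₁ = solve-∀
  2n<3[1+m] : n + n < 3 * suc m
  2n<3[1+m] = subst (n + n <_) (*-comm (suc m) 3) (begin-strict
    n + n               ≡⟨ m≡m%n+[m/n]*n (n + n) 3 ⟩
    (n + n) % 3 + m * 3 <⟨ +-monoˡ-< (m * 3) (m%n<n (n + n) 3) ⟩
    3 + m * 3           ∎)
  3m≤2n : 3 * m ≤ n + n
  3m≤2n = subst (_≤ n + n) (*-comm m 3) (m/n*n≤m (n + n) 3)
  4^n≤ : 4 ^ n ≤ 4 ^ (e * t + m)
  4^n≤ = begin
    4 ^ n                               ≤⟨ 4^n≤2n*binom n ⟩
    2 * n * binom n n                   ≡⟨ cong (λ k → (n + k) * binom n n) (+-identityʳ n) ⟩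
    (n + n) * binom n n                 ≤⟨ *-monoʳ-≤ (n + n) (noPrimes⇒binom-bound n s m 2<n
                                             (subst (λ u → n + n < u * u) (sym (suc-pred t)) (subst (n + n <_) (sym 2^*2^≡4^) 2n<4^e))
                                             2n<3[1+m] noPrime) ⟩
    (n + n) * ((n + n) ^ s * m #)       ≡⟨ *-assoc (n + n) ((n + n) ^ s) (m #) ⟨
    (n + n) ^ suc s * m #               ≡⟨ cong (λ u → (n + n) ^ u * m #) (suc-pred t) ⟩
    (n + n) ^ t * m #                   ≤⟨ *-mono-≤ (^-monoˡ-≤ t (<⇒≤ 2n<4^e)) (n#≤4^n m) ⟩
    (4 ^ e) ^ t * 4 ^ m                 ≡⟨ cong (_* 4 ^ m) (^-*-assoc 4 e t) ⟩
    4 ^ (e * t) * 4 ^ m                 ≡⟨ ^-distribˡ-+-* 4 (e * t) m ⟨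
    4 ^ (e * t + m)                     ∎
  n≤et+m : n ≤ e * t + m
  n≤et+m = ≮⇒≥ λ et+m<n → contradiction 4^n≤ (<⇒≱ (^-monoʳ-< 4 (s≤s (s≤s z≤n)) et+m<n))
  n≤3et : n ≤ 3 * (e * t)
  n≤3et = +-cancelʳ-≤ (n + n) n (3 * (e * t)) (begin
    n + (n + n)           ≡⟨ cong (λ k → n + (n + k)) (+-identityʳ n) ⟨
    3 * n                 ≤⟨ *-monoʳ-≤ 3 n≤et+m ⟩
    3 * (e * t + m)       ≡⟨ *-distribˡ-+ 3 (e * t) m ⟩
    3 * (e * t) + 3 * m   ≤⟨ +-monoʳ-≤ (3 * (e * t)) 3m≤2n ⟩
    3 * (e * t) + (n + n) ∎)

-- If the next prime after `n` exceeded `n + n`, then `noPrimes⇒2^e≤24e` would apply with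
-- `4 ^ suc e` the least power of 4 above `n + n`. The threshold `4 ^ 7` forces `8 ≤ suc e`, where
-- the inequality is false.
bertrand[4^7≤n] : ∀ n → 4 ^ 7 ≤ n → ∃[ p ] (Prime p × n < p × p ≤ n + n)
bertrand[4^7≤n] n 4^7≤n with nextPrime n
... | record { value = p ; isPrime = pp ; greater = n<p ; least = least } with p ≤? n + n
...   | yes p≤2n = p , pp , n<p , p≤2n
...   | no  p≰2n
  with e , 4^e≤2n , 2n<4^[1+e] ← ∃-log₄ (n + n) {{>-nonZero (<-≤-trans (m^n>0 4 7) (≤-trans 4^7≤n (m≤m+n n n)))}}
  = contradiction
      (noPrimes⇒2^e≤24e n (suc e) (≤-trans (≤ᵇ⇒≤ 3 (4 ^ 7) _) 4^7≤n) (*-monoʳ-≤ 4 4^e≤2n) 2n<4^[1+e]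
        (λ {q} pq n<q → <-≤-trans (≰⇒> p≰2n) (least q pq n<q)))
      (<⇒≱ (subst (λ e → 24 * e < 2 ^ e) (m+[n∸m]≡n 8≤1+e) (24*[8+e]<2^[8+e] (suc e ∸ 8))))
  where
  8≤1+e : 8 ≤ suc e
  8≤1+e = ≮⇒≥ λ { (s≤s 1+e≤7) → contradiction (≤-trans 4^7≤n (m≤m+n n n))
    (<⇒≱ (<-≤-trans 2n<4^[1+e] (^-monoʳ-≤ 4 1+e≤7))) }

-- Abstract, so that the type checker never evaluates the threshold.
abstract
  bertrand : ∃[ N ] (∀ n → N ≤ n → ∃[ p ] (Prime p × n < p × p ≤ n + n))
  bertrand = 4 ^ 7 , bertrand[4^7≤n]

-- Primes dividing the five sequences exactly once.

-- `prime²∤` sets no upper bound on `p`: it is also applied to factors whose own `e` is smaller than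
-- the chosen prime.
record SimplePrimes (h e : ℕ) : Set where
  field
    prime∣   : ∀ {p} → Prime p → 2 < p → p ≤ e → e < 2 * p → p ∣ h
    prime²∤  : ∀ {p} → Prime p → 2 < p → e < 2 * p → p ^ 2 ∤ h

open SimplePrimes

!-simplePrimes : ∀ n → SimplePrimes (n !) n
!-simplePrimes n .prime∣  pp _ p≤n _ = m∣n! (<-trans z<s (prime⇒1< pp)) p≤n
!-simplePrimes n .prime²∤ pp _ n<2p  = prime^∤! pp 1 (prime⇒1< pp) n<2p

[m+m]!!≡2^m*m! : ∀ m → (m + m) !! ≡ 2 ^ m * m !
[m+m]!!≡2^m*m! zero    = refl
[m+m]!!≡2^m*m! (suc m) = begin
  suc (m + suc m) !!              ≡⟨ cong (λ n → suc n !!) (+-suc m m) ⟩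
  (2 + (m + m)) * (m + m) !!      ≡⟨ cong ((2 + (m + m)) *_) ([m+m]!!≡2^m*m! m) ⟩
  (2 + (m + m)) * (2 ^ m * m !)   ≡⟨ eq m (2 ^ m) (m !) ⟩
  2 * 2 ^ m * (suc m * m !)       ∎
  where
  open ≡-Reasoning
  eq : ∀ m u v → (2 + (m + m)) * (u * v) ≡ 2 * u * (suc m * v)
  eq = solve-∀

[1+n]!!*n!!≡[1+n]! : ∀ n → suc n !! * n !! ≡ suc n !
[1+n]!!*n!!≡[1+n]! zero    = refl
[1+n]!!*n!!≡[1+n]! (suc n) = begin
  (2 + n) * n !! * suc n !!    ≡⟨ *-assoc (2 + n) (n !!) (suc n !!) ⟩
  (2 + n) * (n !! * suc n !!)  ≡⟨ cong ((2 + n) *_) (*-comm (n !!) (suc n !!)) ⟩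
  (2 + n) * (suc n !! * n !!)  ≡⟨ cong ((2 + n) *_) ([1+n]!!*n!!≡[1+n]! n) ⟩
  (2 + n) * suc n !            ∎
  where open ≡-Reasoning

-- The size is `m` because (2m)!! = 2^m m!, and an odd prime does not divide the power of 2.
!!-even-simplePrimes : ∀ m → SimplePrimes ((m + m) !!) m
!!-even-simplePrimes m .prime∣ {p} pp 2<p p≤m m<2p =
  subst (p ∣_) (sym ([m+m]!!≡2^m*m! m)) (∣n⇒∣m*n (2 ^ m) (prime∣ (!-simplePrimes m) pp 2<p p≤m m<2p))
!!-even-simplePrimes m .prime²∤ {p} pp 2<p m<2p p²∣ =
  prime²∤ (!-simplePrimes m) pp 2<p m<2p
    (prime^-cancelˡ-∣ pp (prime∤^ pp (>⇒∤ 2<p) m) 2 (subst (p ^ 2 ∣_) ([m+m]!!≡2^m*m! m) p²∣))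

-- (2m+1)!! (2m)!! = (2m+1)!, and a prime `p > 2` with `m < p` does not divide (2m)!! = 2^m m!.
!!-odd-simplePrimes : ∀ m → SimplePrimes (suc (m + m) !!) (suc (m + m))
!!-odd-simplePrimes m .prime∣ {p} pp 2<p p≤n n<2p =
  [ (λ p∣ → p∣)
  , (λ p∣ → contradiction (subst (p ∣_) ([m+m]!!≡2^m*m! m) p∣)
      (prime∤* pp (prime∤^ pp (>⇒∤ 2<p) m) (prime∤! pp m<p))) ]′
  (euclidsLemma (suc (m + m) !!) ((m + m) !!) pp
    (subst (p ∣_) (sym ([1+n]!!*n!!≡[1+n]! (m + m))) (prime∣ (!-simplePrimes (suc (m + m))) pp 2<p p≤n n<2p)))
  where
  m<p : m < p
  m<p = *-cancelˡ-< 2 m p (subst (_< 2 * p) (cong (m +_) (sym (+-identityʳ m))) (<-trans (n<1+n (m + m)) n<2p))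
!!-odd-simplePrimes m .prime²∤ {p} pp 2<p n<2p p²∣ =
  prime²∤ (!-simplePrimes (suc (m + m))) pp 2<p n<2p
    (subst (p ^ 2 ∣_) ([1+n]!!*n!!≡[1+n]! (m + m)) (∣m⇒∣m*n ((m + m) !!) p²∣))

lcmUpTo-simplePrimes : ∀ n → .{{NonZero n}} → SimplePrimes (lcmUpTo n) n
lcmUpTo-simplePrimes n .prime∣ pp _ p≤n _ = ∣lcmUpTo (<-trans z<s (prime⇒1< pp)) p≤n
lcmUpTo-simplePrimes n .prime²∤ {p} pp 2<p n<2p p²∣ = <⇒≱ n<2p (begin
  2 * p       ≤⟨ *-monoˡ-≤ p (<⇒≤ 2<p) ⟩
  p * p       ≡⟨ cong (p *_) (*-identityʳ p) ⟨
  p ^ 2       ≤⟨ prime^∣lcmUpTo⇒≤ pp 2 p²∣ ⟩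
  n           ∎)
  where open ≤-Reasoning

prime∣prime⇒≡ : ∀ {p q} → Prime p → Prime q → p ∣ q → p ≡ q
prime∣prime⇒≡ pp pq p∣q =
  [ (λ { refl → contradiction pp ¬prime[1] }) , (λ p≡q → p≡q) ]′ (prime⇒irreducible pq p∣q)

prime²∤# : ∀ {p} → Prime p → ∀ n → p ^ 2 ∤ n #
prime²∤# {p} pp zero    p²∣ = prime∤1 pp (∣-trans (m∣m*n (p ^ 1)) p²∣)
prime²∤# {p} pp (suc n) p²∣ with prime? (suc n)
... | no ¬pr = prime²∤# pp n (subst (p ^ 2 ∣_) (#-suc-¬prime ¬pr) p²∣)
... | yes pr with p²∣pn# ← subst (p ^ 2 ∣_) (#-suc-prime pr) p²∣ | p ∣? suc n
...   | no p∤1+n = prime²∤# pp n (prime^-cancelˡ-∣ pp p∤1+n 2 p²∣pn#)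
...   | yes p∣1+n with refl ← prime∣prime⇒≡ pp pr p∣1+n =
  prime∤# pr (n<1+n n) (∣-trans (m∣m*n 1) (*-cancelˡ-∣ (suc n) p²∣pn#))

#-simplePrimes : ∀ n → SimplePrimes (n #) n
#-simplePrimes n .prime∣  pp _ p≤n _ =
  ∈⇒∣product (∈-filter⁺ prime? (∈-oneTo (<-trans z<s (prime⇒1< pp)) p≤n) pp)
#-simplePrimes n .prime²∤ pp _ _     = prime²∤# pp n

#-constant : ∀ a k → (∀ {q} → Prime q → a < q → k + a < q) → (k + a) # ≡ a #
#-constant a zero    _       = refl
#-constant a (suc k) noPrime = trans
  (#-suc-¬prime λ pr → <-irrefl refl (noPrime pr (s≤s (m≤n+m a k))))
  (#-constant a k λ pq a<q → <-trans (n<1+n (k + a)) (noPrime pq a<q))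

nextPrime-# : ∀ {n} (np : NextPrime n) → let open NextPrime np in value # ≡ value * n #
nextPrime-# record { value = zero ; greater = () }
nextPrime-# {n} record { value = suc v ; isPrime = pr ; greater = s≤s n≤v ; least = least } =
  trans (#-suc-prime pr) (cong (suc v *_) (subst (λ w → w # ≡ n #) (m∸n+n≡m n≤v)
    (#-constant n (v ∸ n) λ {q} pq n<q → subst (_< q) (sym (m∸n+n≡m n≤v)) (least q pq n<q))))

-- Reduces p_n# to the primorial of p_n: no prime lies strictly between consecutive values of
-- `nthPrime`, so the primorial is constant there.
nthPrimorial≡nthPrime# : ∀ n → nthPrimorial n ≡ nthPrime n #
nthPrimorial≡nthPrime# zero    = refl
nthPrimorial≡nthPrime# (suc n) = begin
  nthPrimorial (suc n)                                ≡⟨ cong (product ∘ map nthPrime) (oneTo-suc n) ⟩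
  product (map nthPrime (oneTo n ++ [ suc n ]))       ≡⟨ cong product (map-++ nthPrime (oneTo n) [ suc n ]) ⟩
  product (map nthPrime (oneTo n) ++ [ nthPrime (suc n) ])
    ≡⟨ product-++ (map nthPrime (oneTo n)) [ nthPrime (suc n) ] ⟩
  nthPrimorial n * (nthPrime (suc n) * 1)             ≡⟨ cong (nthPrimorial n *_) (*-identityʳ _) ⟩
  nthPrimorial n * nthPrime (suc n)                   ≡⟨ cong (_* nthPrime (suc n)) (nthPrimorial≡nthPrime# n) ⟩
  nthPrime n # * nthPrime (suc n)                     ≡⟨ *-comm (nthPrime n #) (nthPrime (suc n)) ⟩
  nthPrime (suc n) * nthPrime n #                     ≡⟨ nextPrime-# (nextPrime (nthPrime n)) ⟨
  nthPrime (suc n) #                                  ∎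
  where open ≡-Reasoning

n≤nthPrime : ∀ n → n ≤ nthPrime n
n≤nthPrime zero    = z≤n
n≤nthPrime (suc n) = ≤-<-trans (n≤nthPrime n) (NextPrime.greater (nextPrime (nthPrime n)))

-- Treats the five kinds uniformly: primes above `A` see only `core`. The factor 2 in `n≤1+2size`
-- serves even double factorials, whose size is half of `n`.
record Decomposition (k : Kind) (A n : ℕ) : Set where
  field
    exponent core size : ℕ
    H≡            : H k A n ≡ A ^ exponent * core
    n≤1+2size     : n ≤ suc (size + size)
    simplePrimes  : SimplePrimes core size

decompose : ∀ k A n → .{{NonZero n}} → Decomposition k A n
decompose factorial A n = record
  { exponent = n ; H≡ = refl ; n≤1+2size = m≤n⇒m≤1+n (m≤m+n n n) ; simplePrimes = !-simplePrimes n }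
decompose doubleFactorial A n with even⊎odd n
... | m , inj₁ refl = record
  { exponent = m + m ; H≡ = refl ; n≤1+2size = n≤1+n (m + m) ; simplePrimes = !!-even-simplePrimes m }
... | m , inj₂ refl = record
  { exponent = m + suc m ; H≡ = refl ; n≤1+2size = m≤n⇒m≤1+n (m≤m+n (m + suc m) (m + suc m))
  ; simplePrimes = subst (λ n → SimplePrimes (n !!) n) (sym (+-suc m m)) (!!-odd-simplePrimes m) }
decompose lcmOfFirst A n = record
  { exponent = n ; H≡ = refl ; n≤1+2size = m≤n⇒m≤1+n (m≤m+n n n) ; simplePrimes = lcmUpTo-simplePrimes n }
decompose primorial A n = record
  { exponent = n ; H≡ = refl ; n≤1+2size = m≤n⇒m≤1+n (m≤m+n n n) ; simplePrimes = #-simplePrimes n }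
decompose primePrimorial A n = record
  { exponent = nthPrime n
  ; H≡ = cong (A ^ nthPrime n *_) (nthPrimorial≡nthPrime# n)
  ; n≤1+2size = m≤n⇒m≤1+n (≤-trans (n≤nthPrime n) (m≤m+n _ _))
  ; simplePrimes = #-simplePrimes (nthPrime n) }

-- Bounding the indices of a solution.

-- Each of the `r` factors supplies at most one `p`; the induction gives up one power of `p` per
-- factor.
prime^∤product : ∀ {p} → Prime p → ∀ {r} (h : Fin r → ℕ) → (∀ i → p ^ 2 ∤ h i) →
                 p ^ suc r ∤ product (tabulate h)
prime^∤product {p} pp {zero}  h p²∤h p∣ = prime∤1 pp (subst (_∣ 1) (*-identityʳ p) p∣)
prime^∤product {p} pp {suc r} h p²∤h p^∣ = prime^∤product pp (h ∘ suc) (p²∤h ∘ suc) p^∣rest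
  where
  rest = product (tabulate (h ∘ suc))
  instance _ = prime⇒nonZero pp
  p^∣rest : p ^ suc r ∣ rest
  p^∣rest with p ∣? h zero
  ... | no p∤h₀ = prime^-cancelˡ-∣ pp p∤h₀ (suc r) (∣-trans (n∣m*n p) p^∣)
  ... | yes (divides q h₀≡qp) = prime^-cancelˡ-∣ pp p∤q (suc r)
    (*-cancelˡ-∣ p (subst (p ^ suc (suc r) ∣_) (trans (cong (_* rest) h₀≡qp) (eq p q rest)) p^∣))
    where
    eq : ∀ p q x → q * p * x ≡ p * (q * x)
    eq = solve-∀
    p∤q : p ∤ q
    p∤q p∣q = p²∤h zero (subst₂ _∣_ (cong (p *_) (sym (*-identityʳ p))) (sym h₀≡qp) (*-monoˡ-∣ p p∣q))

∃-argmax : ∀ {r} (f : Fin (suc r) → ℕ) → ∃[ i ] (∀ j → f j ≤ f i)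
∃-argmax {zero}  f = zero , λ { zero → ≤-refl }
∃-argmax {suc r} f with i , f≤fi ← ∃-argmax (f ∘ suc) | ≤-total (f zero) (f (suc i))
... | inj₁ f₀≤ = suc i , λ { zero → f₀≤ ; (suc j) → f≤fi j }
... | inj₂ ≤f₀ = zero  , λ { zero → ≤-refl ; (suc j) → ≤-trans (f≤fi j) ≤f₀ }

powerProduct-bounded : ∀ r d → suc r < d → (A : Fin (suc r) → ℕ) → (∀ i → A i ≥ 1) → (kind : Fin (suc r) → Kind) →
  ∃[ b ] (∀ y ns → (∀ i → lookup ns i ≥ 1) → y ^ d ≡ ∏H kind A ns → ∀ i → lookup ns i ≤ b)
-- All sizes turn out to be at most `c + c`, and an index is at most one more than twice its size.
powerProduct-bounded r d r<d A A≥1 kind = suc (c + c + (c + c)) , bound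
  where
  iᴬ = proj₁ (∃-argmax A)
  N₀ = proj₁ bertrand
  -- For `m ≥ c`, `bertrand` applies to `m`, and every prime above `m` exceeds 2 and all `A i`.
  c = 2 + N₀ + A iᴬ
  bound : ∀ y ns → (∀ i → lookup ns i ≥ 1) → y ^ d ≡ ∏H kind A ns → ∀ i → lookup ns i ≤ suc (c + c + (c + c))
  bound y ns ns≥1 y^d≡ i =
    ≤-trans (n≤1+2size (D i)) (s≤s (+-mono-≤ (≤-trans (e≤N i) N≤2c) (≤-trans (e≤N i) N≤2c)))
    where
    open Decomposition
    D : ∀ i → Decomposition (kind i) (A i) (lookup ns i)
    D i = decompose (kind i) (A i) (lookup ns i) {{>-nonZero (ns≥1 i)}}
    i₀ = proj₁ (∃-argmax (λ i → size (D i)))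
    N = size (D i₀)
    e≤N : ∀ i → size (D i) ≤ N
    e≤N = proj₂ (∃-argmax (λ i → size (D i)))

    noPrime : ∀ {p} → Prime p → 2 < p → A iᴬ < p → p ≤ N → ¬ N < 2 * p
    -- The factor of largest size makes `p` divide `y`, so `p ^ d` divides the product, whose
    -- `suc r < d` factors supply at most `suc r` copies of `p`.
    noPrime {p} pp 2<p A<p p≤N N<2p = prime^∤product pp _ p²∤H
      (∣-trans (^-monoʳ-∣ p r<d) (subst (p ^ d ∣_) y^d≡ (^-mono-∣ d p∣y)))
      where
      p²∤H : ∀ i → p ^ 2 ∤ H (kind i) (A i) (lookup ns i)
      p²∤H i p²∣ = prime²∤ (simplePrimes (D i)) pp 2<p (≤-<-trans (e≤N i) N<2p)
        (prime^-cancelˡ-∣ pp (prime∤^ pp p∤A (exponent (D i))) 2 (subst (p ^ 2 ∣_) (H≡ (D i)) p²∣))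
        where
        p∤A : p ∤ A i
        p∤A = >⇒∤ {{>-nonZero (A≥1 i)}} (≤-<-trans (proj₂ (∃-argmax A) i) A<p)
      p∣y : p ∣ y
      p∣y = prime∣^⇒∣ pp d (subst (p ∣_) (sym y^d≡) (∣-trans
        (subst (p ∣_) (sym (H≡ (D i₀))) (∣n⇒∣m*n (A i₀ ^ exponent (D i₀)) (prime∣ (simplePrimes (D i₀)) pp 2<p p≤N N<2p)))
        (∈⇒∣product (∈-tabulate⁺ {f = λ i → H (kind i) (A i) (lookup ns i)} i₀))))

    ⌊N/2⌋<c : ∀ m → m + m ≤ N → N ≤ suc (m + m) → m < c
    ⌊N/2⌋<c m 2m≤N N≤1+2m = ≰⇒> λ c≤m →
      let 2+N₀≤m = ≤-trans (m≤m+n (2 + N₀) (A iᴬ)) c≤m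
          p , pp , m<p , p≤2m = proj₂ bertrand m (≤-trans (m≤n+m N₀ 2) 2+N₀≤m)
      in noPrime pp (≤-<-trans (≤-trans (m≤m+n 2 N₀) 2+N₀≤m) m<p)
           (≤-<-trans (≤-trans (m≤n+m (A iᴬ) (2 + N₀)) c≤m) m<p)
           (≤-trans p≤2m 2m≤N)
           -- N ≤ 2m + 1 < 2(m + 1) ≤ 2p, which covers both parities of `N`.
           (≤-<-trans N≤1+2m (subst₂ _≤_ (cong suc (+-suc m m)) (cong (p +_) (sym (+-identityʳ p))) (+-mono-≤ m<p m<p)))

    N≤2c : N ≤ c + c
    N≤2c with even⊎odd N
    ... | m , inj₁ N≡ = ≤-trans (≤-reflexive N≡) (+-mono-≤ m≤c m≤c)
      where m≤c = <⇒≤ (⌊N/2⌋<c m (≤-reflexive (sym N≡)) (≤-trans (≤-reflexive N≡) (n≤1+n (m + m))))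
    ... | m , inj₂ N≡ = ≤-trans (≤-reflexive N≡) (+-mono-≤ (<⇒≤ m<c) m<c)
      where
      N≡′ : N ≡ suc (m + m)
      N≡′ = trans N≡ (+-suc m m)
      m<c = ⌊N/2⌋<c m (≤-trans (n≤1+n (m + m)) (≤-reflexive (sym N≡′))) (≤-reflexive N≡′)

-- Enumerating the remaining candidates.

open import Data.Integer.Base using (+_; -[1+_])

-- `Finite` asks for a list of exactly the solutions, so a list of candidates is cut down by
-- deciding `P`.
finite-filter : ∀ {a ℓ} {X : Set a} {P : X → Set ℓ} → Decidable P → ∀ xs → (∀ x → P x → x ∈ xs) → Finite P
finite-filter P? xs P⇒∈ = filter P? xs , λ x →
  mk⇔ (λ px → ∈-filter⁺ P? (P⇒∈ x px) px) (λ x∈ → proj₂ (∈-filter⁻ P? {xs = xs} x∈))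

vecsUpTo : ℕ → ∀ r → List (Vec ℕ r)
vecsUpTo b zero    = [ [] ]
vecsUpTo b (suc r) = cartesianProductWith _∷_ (upTo (suc b)) (vecsUpTo b r)

∈-vecsUpTo : ∀ {b r} (ns : Vec ℕ r) → (∀ i → lookup ns i ≤ b) → ns ∈ vecsUpTo b r
∈-vecsUpTo []       _    = here refl
∈-vecsUpTo (n ∷ ns) ns≤b =
  ∈-cartesianProductWith⁺ _∷_ (∈-upTo⁺ (s≤s (ns≤b zero))) (∈-vecsUpTo ns (ns≤b ∘ suc))

integersUpTo : ℕ → List ℤ
integersUpTo b = map +_ (upTo (suc b)) ++ map -[1+_] (upTo b)

∈-integersUpTo : ∀ {b} x → abs x ≤ b → x ∈ integersUpTo b
∈-integersUpTo (+ n)      n≤b = ∈-++⁺ˡ (∈-map⁺ +_ (∈-upTo⁺ (s≤s n≤b)))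
∈-integersUpTo {b} (-[1+ n ]) n<b = ∈-++⁺ʳ (map +_ (upTo (suc b))) (∈-map⁺ -[1+_] (∈-upTo⁺ n<b))

abs-^ : ∀ x n → abs (x ℤ.^ n) ≡ abs x ^ n
abs-^ x zero    = refl
abs-^ x (suc n) = trans (ℤ.abs-* x (x ℤ.^ n)) (cong (abs x *_) (abs-^ x n))

m≤m^n : ∀ m n → .{{NonZero n}} → m ≤ m ^ n
m≤m^n zero    n       = z≤n
m≤m^n m@(suc _) (suc n) = m≤m*n m (m ^ n) {{m^n≢0 m n}}

theorem6 : (r d : ℕ) → r ≥ 1 → d > r →
           (A : Fin r → ℕ) → (∀ i → A i ≥ 1) →
           (kind : Fin r → Kind) →
           Finite {A = ℤ × Vec ℕ r} (λ (x , ns) → VecAll.All (_≥ 1) ns × x ℤ.^ d ≡ + ∏H kind A ns)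
theorem6 (suc r) d r≥1 d>r A A≥1 kind = finite-filter
  (λ (x , ns) → VecAll.all? (1 ≤?_) ns ×-dec x ℤ.^ d ℤ.≟ + ∏H kind A ns)
  -- Given `ns`, the absolute value of `x` is at most its `d`-th power, which is the product.
  (concatMap (λ ns → map (_, ns) (integersUpTo (∏H kind A ns))) (vecsUpTo b (suc r)))
  λ (x , ns) (ns≥1 , x^d≡) →
    let ∣x∣^d≡ = trans (sym (abs-^ x d)) (cong abs x^d≡)
        ns∈    = ∈-vecsUpTo ns (bounded (abs x) ns (VecAll.lookup⁺ ns≥1) ∣x∣^d≡)
        x∈     = ∈-integersUpTo x (subst (abs x ≤_) ∣x∣^d≡ (m≤m^n (abs x) d {{>-nonZero (<-trans z<s d>r)}}))
    in ∈-concatMap⁺ _ (Any.map (λ { refl → ∈-map⁺ (_, ns) x∈ }) ns∈)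
  where
  b = proj₁ (powerProduct-bounded r d d>r A A≥1 kind)
  bounded = proj₂ (powerProduct-bounded r d d>r A A≥1 kind)
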